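{- Let $D$ be a digraph on $n$ vertices that has at least one out-branching. If $D$ has minimum in-degree at least $3$, or if $D$ is an oriented graph with minimum in-degree at least $2$, then $\ell(D)\geq \frac{1}{4}\sqrt{n}$.
   Context: An out-tree of a digraph $D$ is a subgraph of $D$ that is a tree (ignoring arc directions) in which exactly one vertex, the root, has in-degree $0$ and every other vertex has in-degree $1$. An out-branching is a spanning out-tree. A leaf is a vertex of out-degree $0$ in the out-tree. $\ell(D)$ denotes the maximum number of leaves over all out-trees of $D$. A digraph is an oriented graph if $(u,v)\in A(D)$ implies $(v,u)\notin A(D)$. -}

module Defs where

open import Data.Bool.Base using (true; false)
open import Data.Empty using (⊥)
open import Data.Fin.Base using (Fin; zero; suc)
open import Data.Fin.Properties as Fin using (any?; all?; injective⇒≤)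
open import Data.Fin.Subset using (Subset; inside; outside; _∈_; ∣_∣)
open import Data.Fin.Subset.Properties using (_∈?_)
open import Data.List.Base as List using (List; []; _∷_; _∷ʳ_; length; map; filter; allFin; cartesianProduct; cartesianProductWith)
open import Data.List.Extrema.Nat using (max; xs≤max; argmax-sel)
open import Data.List.Membership.Propositional as List using ()
open import Data.List.Membership.Propositional.Properties using (∈-map⁺; ∈-map⁻; ∈-filter⁺; ∈-filter⁻; ∈-cartesianProduct⁺; ∈-cartesianProductWith⁺; ∈-allFin; ∈-lookup)
open import Data.List.Relation.Unary.All as All using ([]; _∷_)
open import Data.List.Relation.Unary.AllPairs using (_∷_)
open import Data.List.Relation.Unary.Any using (here; there)
open import Data.List.Relation.Unary.Linked using (Linked; linked?)
open import Data.List.Relation.Unary.Unique.Propositional using (Unique)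
import Data.List.Relation.Unary.Unique.DecPropositional as DecUnique
open import Data.Nat.Base using (ℕ; zero; suc; _≤_; z≤n; s≤s)
open import Data.Nat.Properties as ℕ using (n≤0⇒n≡0)
open import Data.Product.Base using (∃-syntax; _×_; _,_; proj₁; proj₂)
open import Data.Sum.Base using (_⊎_; inj₁; inj₂)
open import Data.Vec.Base as Vec using (Vec; tabulate)
open import Function.Base using (_∘_; id)
open import Function.Definitions using (Injective)
open import Level using (0ℓ)
open import Relation.Binary.Core using (Rel)
open import Relation.Binary.Definitions using (Decidable)
open import Relation.Binary.Construct.Closure.Equivalence using (EqClosure)
open import Relation.Binary.Construct.Closure.ReflexiveTransitive using (Star; ε; _◅_; _◅◅_)
open import Relation.Binary.Construct.Closure.Symmetric using (SymClosure; fwd; bwd)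
open import Relation.Binary.PropositionalEquality using (_≡_; _≢_; refl; sym; trans; cong; subst)
open import Relation.Nullary using (¬_; Dec; no; does; contradiction)
open import Relation.Nullary.Decidable using (map′; _×-dec_; _⊎-dec_; _→-dec_; ¬?)
open import Relation.Unary using (Pred)

private
  variable
    n : ℕ

-- A set of ordered pairs of vertices, as an adjacency matrix: row u is
-- the set of heads of the arcs with tail u.
ArcSet : ℕ → Set
ArcSet n = Vec (Subset n) n

Arc : ArcSet n → Rel (Fin n) 0ℓ
Arc A u v = v ∈ Vec.lookup A u

inNeighbours outNeighbours : ArcSet n → Fin n → Subset n
inNeighbours  A v = Vec.map (λ row → Vec.lookup row v) A
outNeighbours A u = Vec.lookup A u

inDegree outDegree : ArcSet n → Fin n → ℕ
inDegree  A v = ∣ inNeighbours A v ∣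
outDegree A u = ∣ outNeighbours A u ∣

-- Finite digraphs with vertex set Fin n, without loops and without
-- parallel arcs; pairs of opposite arcs are allowed.
record Digraph (n : ℕ) : Set where
  field
    arcs     : ArcSet n
    loopless : ∀ v → ¬ Arc arcs v v

open Digraph public

IsOriented : Digraph n → Set
IsOriented D = ∀ u v → Arc (arcs D) u v → ¬ Arc (arcs D) v u

MinInDegree≥ : ℕ → Digraph n → Set
MinInDegree≥ k D = ∀ v → k ≤ inDegree (arcs D) v

-- Arc directions are ignored, and opposite arcs give a single edge.
Adjacent : ArcSet n → Rel (Fin n) 0ℓ
Adjacent A = SymClosure (Arc A)

Connected : Subset n → ArcSet n → Set
Connected V A = ∀ u v → u ∈ V → v ∈ V → EqClosure (Arc A) u v

-- The list holds the vertices of the cycle in order; the edge closing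
-- the cycle is obtained by repeating the first vertex at the end.
IsCycle : ArcSet n → List (Fin n) → Set
IsCycle A []       = ⊥
IsCycle A (x ∷ xs) =
  3 ≤ length (x ∷ xs) × Unique (x ∷ xs) × Linked (Adjacent A) (x ∷ xs ∷ʳ x)

Acyclic : ArcSet n → Set
Acyclic A = ∀ xs → ¬ IsCycle A xs

-- Vertex set and arc set; the incidence condition is part of IsSubgraph.
Subgraph : ℕ → Set
Subgraph n = Subset n × ArcSet n

record IsSubgraph (D : Digraph n) (H : Subgraph n) : Set where
  field
    arcs⊆ : ∀ u v → Arc (proj₂ H) u v → Arc (arcs D) u v
    ends  : ∀ u v → Arc (proj₂ H) u v → u ∈ proj₁ H × v ∈ proj₁ H

record IsTree (H : Subgraph n) : Set where
  field
    nonempty  : ∃[ v ] v ∈ proj₁ H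
    connected : Connected (proj₁ H) (proj₂ H)
    acyclic   : Acyclic (proj₂ H)

IsRoot : Subgraph n → Fin n → Set
IsRoot (V , A) r =
  r ∈ V × inDegree A r ≡ 0 × (∀ v → v ∈ V → v ≢ r → inDegree A v ≡ 1)

record IsOutTree (D : Digraph n) (H : Subgraph n) : Set where
  field
    isSubgraph : IsSubgraph D H
    isTree     : IsTree H
    rooted     : ∃[ r ] IsRoot H r

IsOutBranching : Digraph n → Subgraph n → Set
IsOutBranching D H = IsOutTree D H × (∀ v → v ∈ proj₁ H)

HasOutBranching : Digraph n → Set
HasOutBranching D = ∃[ H ] IsOutBranching D H

leaves : Subgraph n → Subset n
leaves (V , A) = tabulate λ v → does ((v ∈? V) ×-dec (outDegree A v ℕ.≟ 0))

private

  arc? : (A : ArcSet n) → Decidable (Arc A)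
  arc? A u v = v ∈? Vec.lookup A u

  adjacent? : (A : ArcSet n) → Decidable (Adjacent A)
  adjacent? A u v = map′ to from (arc? A u v ⊎-dec arc? A v u)
    where
    to : Arc A u v ⊎ Arc A v u → Adjacent A u v
    to (inj₁ a) = fwd a
    to (inj₂ a) = bwd a
    from : Adjacent A u v → Arc A u v ⊎ Arc A v u
    from (fwd a) = inj₁ a
    from (bwd a) = inj₂ a

  -- Warshall's algorithm: Via xs u v says that there is a walk from u
  -- to v all of whose intermediate vertices lie in xs.
  module Warshall (R : Rel (Fin n) 0ℓ) (R? : Decidable R) where

    Via : List (Fin n) → Rel (Fin n) 0ℓ
    Via []       u v = u ≡ v ⊎ R u v
    Via (x ∷ xs) u v = Via xs u v ⊎ (Via xs u x × Via xs x v)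

    via? : ∀ xs → Decidable (Via xs)
    via? []       u v = (u Fin.≟ v) ⊎-dec R? u v
    via? (x ∷ xs) u v = via? xs u v ⊎-dec (via? xs u x ×-dec via? xs x v)

    sound : ∀ xs {u v} → Via xs u v → Star R u v
    sound []       (inj₁ refl)    = ε
    sound []       (inj₂ r)       = r ◅ ε
    sound (x ∷ xs) (inj₁ p)       = sound xs p
    sound (x ∷ xs) (inj₂ (p , q)) = sound xs p ◅◅ sound xs q

    join : ∀ xs {u v x} → x List.∈ xs → Via xs u x → Via xs x v → Via xs u v
    join (y ∷ ys) (here refl) p q = inj₂ (before p , after q)
      where
      before : ∀ {u} → Via (y ∷ ys) u y → Via ys u y
      before (inj₁ p)       = p
      before (inj₂ (p , _)) = p
      after : ∀ {v} → Via (y ∷ ys) y v → Via ys y v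
      after (inj₁ p)       = p
      after (inj₂ (_ , p)) = p
    join (y ∷ ys) (there i) (inj₁ p)       (inj₁ q)       = inj₁ (join ys i p q)
    join (y ∷ ys) (there i) (inj₁ p)       (inj₂ (q , r)) = inj₂ (join ys i p q , r)
    join (y ∷ ys) (there i) (inj₂ (p , q)) (inj₁ r)       = inj₂ (p , join ys i q r)
    join (y ∷ ys) (there i) (inj₂ (p , _)) (inj₂ (_ , s)) = inj₂ (p , s)

    base : ∀ xs {u v} → u ≡ v ⊎ R u v → Via xs u v
    base []       p = p
    base (x ∷ xs) p = inj₁ (base xs p)

    complete : ∀ {u v} → Star R u v → Via (allFin n) u v
    complete ε        = base (allFin n) (inj₁ refl)
    complete (r ◅ rs) =
      join (allFin n) (∈-allFin _) (base (allFin n) (inj₂ r)) (complete rs)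

    star? : Decidable (Star R)
    star? u v = map′ (sound (allFin n)) complete (via? (allFin n) u v)

  lookup-injective : {xs : List (Fin n)} → Unique xs → Injective _≡_ _≡_ (List.lookup xs)
  lookup-injective (_  ∷ _) {zero}  {zero}  _ = refl
  lookup-injective (px ∷ _) {zero}  {suc j} e = contradiction e (All.lookup px (∈-lookup j))
  lookup-injective (px ∷ _) {suc i} {zero}  e = contradiction (sym e) (All.lookup px (∈-lookup i))
  lookup-injective (_  ∷ u) {suc i} {suc j} e = cong suc (lookup-injective u e)

  shortList? : ∀ k {P : Pred (List (Fin n)) 0ℓ} → (∀ xs → Dec (P xs)) →
               Dec (∃[ xs ] length xs ≤ k × P xs)
  shortList? zero {P} P? = map′ (λ p → [] , z≤n , p) from (P? [])
    where
    from : ∃[ xs ] length xs ≤ zero × P xs → P []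
    from ([] , _ , p) = p
  shortList? (suc k) {P} P? =
    map′ to from (P? [] ⊎-dec any? λ x → shortList? k (P? ∘ (x ∷_)))
    where
    to : P [] ⊎ (∃[ x ] ∃[ xs ] length xs ≤ k × P (x ∷ xs)) →
         ∃[ xs ] length xs ≤ suc k × P xs
    to (inj₁ p)                 = [] , z≤n , p
    to (inj₂ (x , xs , le , p)) = x ∷ xs , s≤s le , p
    from : ∃[ xs ] length xs ≤ suc k × P xs →
           P [] ⊎ (∃[ x ] ∃[ xs ] length xs ≤ k × P (x ∷ xs))
    from ([]     , _      , p) = inj₁ p
    from (x ∷ xs , s≤s le , p) = inj₂ (x , xs , le , p)

  isCycle? : (A : ArcSet n) → ∀ xs → Dec (IsCycle A xs)
  isCycle? A []       = no id
  isCycle? A (x ∷ xs) =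
    (3 ℕ.≤? length (x ∷ xs)) ×-dec
    DecUnique.unique? Fin._≟_ (x ∷ xs) ×-dec
    linked? (adjacent? A) (x ∷ xs ∷ʳ x)

  cycle-short : (A : ArcSet n) → ∀ xs → IsCycle A xs → length xs ≤ n
  cycle-short A (x ∷ xs) (_ , u , _) = injective⇒≤ (lookup-injective u)

  acyclic? : (A : ArcSet n) → Dec (Acyclic A)
  acyclic? {n} A =
    map′ (λ no-short xs c → no-short (xs , cycle-short A xs c , c))
         (λ acyclic (xs , _ , c) → acyclic xs c)
         (¬? (shortList? n (isCycle? A)))

  isSubgraph? : (D : Digraph n) (H : Subgraph n) → Dec (IsSubgraph D H)
  isSubgraph? D (V , A) =
    map′ (λ (p , q) → record { arcs⊆ = p ; ends = q })
         (λ s → IsSubgraph.arcs⊆ s , IsSubgraph.ends s)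
         ((all? λ u → all? λ v → arc? A u v →-dec arc? (arcs D) u v) ×-dec
          (all? λ u → all? λ v → arc? A u v →-dec ((u ∈? V) ×-dec (v ∈? V))))

  isTree? : (H : Subgraph n) → Dec (IsTree H)
  isTree? (V , A) =
    map′ (λ (p , q , r) → record { nonempty = p ; connected = q ; acyclic = r })
         (λ t → IsTree.nonempty t , IsTree.connected t , IsTree.acyclic t)
         (any? (_∈? V) ×-dec
          (all? λ u → all? λ v → (u ∈? V) →-dec (v ∈? V) →-dec
            Warshall.star? (Adjacent A) (adjacent? A) u v) ×-dec
          acyclic? A)

  isRoot? : (H : Subgraph n) → ∀ r → Dec (IsRoot H r)
  isRoot? (V , A) r =
    (r ∈? V) ×-dec (inDegree A r ℕ.≟ 0) ×-dec
    (all? λ v → (v ∈? V) →-dec ¬? (v Fin.≟ r) →-dec (inDegree A v ℕ.≟ 1))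

isOutTree? : (D : Digraph n) (H : Subgraph n) → Dec (IsOutTree D H)
isOutTree? D H =
  map′ (λ (p , q , r) → record { isSubgraph = p ; isTree = q ; rooted = r })
       (λ t → IsOutTree.isSubgraph t , IsOutTree.isTree t , IsOutTree.rooted t)
       (isSubgraph? D H ×-dec isTree? H ×-dec any? (isRoot? H))

allVecs : {A : Set} → List A → ∀ m → List (Vec A m)
allVecs xs zero    = Vec.[] ∷ []
allVecs xs (suc m) = cartesianProductWith Vec._∷_ xs (allVecs xs m)

allSubsets : ∀ n → List (Subset n)
allSubsets = allVecs (inside ∷ outside ∷ [])

allSubgraphs : ∀ n → List (Subgraph n)
allSubgraphs n = cartesianProduct (allSubsets n) (allVecs (allSubsets n) n)

outTrees : Digraph n → List (Subgraph n)
outTrees D = filter (isOutTree? D) (allSubgraphs _)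

-- The default value 0 matters only for n = 0, where there is no
-- out-tree; see ℓ-attained and ℓ-upper.
ℓ : Digraph n → ℕ
ℓ D = max 0 (map (∣_∣ ∘ leaves) (outTrees D))

∈-allVecs : {A : Set} {xs : List A} → (∀ x → x List.∈ xs) →
            ∀ {m} (v : Vec A m) → v List.∈ allVecs xs m
∈-allVecs all Vec.[]      = here refl
∈-allVecs all (x Vec.∷ v) =
  ∈-cartesianProductWith⁺ Vec._∷_ (all x) (∈-allVecs all v)

∈-allSubsets : (s : Subset n) → s List.∈ allSubsets n
∈-allSubsets = ∈-allVecs λ where
  true  → here refl
  false → there (here refl)

∈-outTrees : (D : Digraph n) {H : Subgraph n} → IsOutTree D H → H List.∈ outTrees D
∈-outTrees D {V , A} = ∈-filter⁺ (isOutTree? D)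
  (∈-cartesianProduct⁺ (∈-allSubsets V) (∈-allVecs ∈-allSubsets A))

ℓ-upper : (D : Digraph n) (H : Subgraph n) → IsOutTree D H → ∣ leaves H ∣ ≤ ℓ D
ℓ-upper D H t =
  All.lookup (xs≤max 0 (map (∣_∣ ∘ leaves) (outTrees D))) (∈-map⁺ (∣_∣ ∘ leaves) (∈-outTrees D t))

ℓ-attained : (D : Digraph n) → ∃[ H ] IsOutTree D H →
             ∃[ H ] IsOutTree D H × ∣ leaves H ∣ ≡ ℓ D
ℓ-attained {n} D (H₀ , t₀) with argmax-sel id 0 (map (∣_∣ ∘ leaves) (outTrees D))
... | inj₁ ℓ≡0 =
  H₀ , t₀ , trans (n≤0⇒n≡0 (subst (∣ leaves H₀ ∣ ≤_) ℓ≡0 (ℓ-upper D H₀ t₀))) (sym ℓ≡0)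
... | inj₂ ℓ∈ with ∈-map⁻ (∣_∣ ∘ leaves) ℓ∈
...   | H , H∈ , eq = H , proj₂ (∈-filter⁻ (isOutTree? D) {xs = allSubgraphs n} H∈) , sym eq

{-# OPTIONS --safe #-}
-- Let k = ℓ(D), and let T be a breadth-first out-branching.  T has at most
-- k leaves and fewer than k branching vertices, and every vertex reaches
-- one of these along a descending path of vertices with a single child, so
-- it is enough to bound the length of such a path by 6k + O(1).  The degree
-- conditions give every vertex of the path an in-neighbour other than its
-- two neighbours on the path; as T is breadth-first, this in-neighbour lies
-- at least two steps further down, or it is not a descendant of the path.
-- A long path then allows T, or a subtree of T, to be rearranged into an
-- out-tree with more than k leaves.

module Submission where

open import Defs
open import Data.Bool.Base using (Bool; true; false; not; _∧_; if_then_else_)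
import Data.Bool.Properties as Bool
open import Data.Fin.Base using (Fin; zero; suc)
import Data.Fin.Properties as Fin
open import Data.Fin.Subset using (Subset; inside; outside; _∈_; ∣_∣)
import Data.Fin.Subset.Properties as Subset
open import Data.List.Base as List
  using (List; []; _∷_; [_]; _∷ʳ_; _++_; length; filter; allFin; upTo; cartesianProductWith)
import Data.List.Membership.DecPropositional as DecMembership
open import Data.List.Membership.Propositional using () renaming (_∈_ to _∈ˡ_; _∉_ to _∉ˡ_)
open import Data.List.Membership.Propositional.Properties
  using (∈-map⁺; ∈-map⁻; ∈-++⁺ˡ; ∈-++⁺ʳ; ∈-++⁻; ∈-filter⁺; ∈-filter⁻; ∈-allFin; ∈-upTo⁺; ∈-upTo⁻; ∈-lookup;
    ∈-cartesianProductWith⁺)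
import Data.List.Properties as List
open import Data.List.Relation.Unary.All as All using (All; []; _∷_)
open import Data.List.Relation.Unary.AllPairs using ([]; _∷_)
open import Data.List.Relation.Unary.Any using (here; there; index)
open import Data.List.Relation.Unary.Any.Properties using (lookup-index)
open import Data.List.Relation.Unary.Linked using (Linked; _∷_)
open import Data.List.Relation.Unary.Unique.Propositional using (Unique)
import Data.List.Relation.Unary.Unique.Propositional.Properties as Unique
open import Data.Nat.Base using (ℕ; zero; suc; pred; _+_; _∸_; _⊔_; _*_; _^_; _≤_; _<_; z≤n; s≤s; s≤s⁻¹)
import Data.Nat.Properties as ℕ
open import Data.Nat.Solver using (module +-*-Solver)
open import Data.Product.Base using (∃-syntax; _×_; _,_; proj₁; proj₂)
open import Data.Sum.Base using (_⊎_; inj₁; inj₂)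
open import Data.Unit.Base using (⊤; tt)
import Data.Vec.Base as Vec
import Data.Vec.Properties as Vec
open import Function.Base using (_∘_; id; case_of_)
open import Relation.Binary.Construct.Closure.Equivalence using (EqClosure)
import Relation.Binary.Construct.Closure.Equivalence as Eq
open import Relation.Binary.Construct.Closure.ReflexiveTransitive using (ε; _◅_; _◅◅_)
open import Relation.Binary.Construct.Closure.Symmetric using (fwd; bwd)
open import Relation.Binary.PropositionalEquality
  using (_≡_; _≢_; refl; sym; trans; cong; cong₂; subst; subst₂)
open import Relation.Nullary using (¬_; Dec; yes; no; does; contradiction)
open import Relation.Nullary.Decidable using (map′; _×-dec_; _⊎-dec_; _→-dec_; ¬?; dec-true; decidable-stable)

-- Hanging every vertex of a long path on its spare in-neighbour need not create leaves: if each
-- spare in-neighbour is the vertex two steps ahead, the result is merely two long paths. Some path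
-- arcs are therefore kept, but only where they give a vertex a further child. Many vertices with
-- siblings force many leaves as well, so a piece of path that can be rehung has at most `3 * ℓ D`
-- vertices. There are two pieces because spare in-neighbours may lie outside the descendants of the
-- path or below its end. Tearing out a stretch of the path detaches what hangs below it, unless the
-- next vertex has a spare in-neighbour outside the descendants on which it can be hung. After the
-- last such vertex, the subtree below the path is itself a sufficient base. Two pieces and the
-- vertex between them give `1 + 6 * ℓ D`, and finally n is at most (6ℓ + 3)(2ℓ - 1), which is below
-- 16ℓ².

private
  variable
    n : ℕ

-- Counting with lists and subsets

module _ {A : Set} where

  lookup-injective : {xs : List A} → Unique xs → ∀ {i j} → List.lookup xs i ≡ List.lookup xs j → i ≡ j
  lookup-injective (_ ∷ _)  {zero}  {zero}  _  = refl
  lookup-injective (p ∷ _)  {zero}  {suc j} eq = contradiction eq (All.lookup p (∈-lookup j))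
  lookup-injective (p ∷ _)  {suc i} {zero}  eq = contradiction (sym eq) (All.lookup p (∈-lookup i))
  lookup-injective (_ ∷ u)  {suc i} {suc j} eq = cong suc (lookup-injective u eq)

  length-⊆ : {xs ys : List A} → Unique xs → (∀ {x} → x ∈ˡ xs → x ∈ˡ ys) → length xs ≤ length ys
  length-⊆ {xs} {ys} u xs⊆ys = Fin.injective⇒≤ {f = position} position-injective
    where
    position : Fin (length xs) → Fin (length ys)
    position i = index (xs⊆ys (∈-lookup i))
    position-injective : ∀ {i j} → position i ≡ position j → i ≡ j
    position-injective {i} {j} eq = lookup-injective u
      (trans (lookup-index (xs⊆ys (∈-lookup i)))
        (trans (cong (List.lookup ys) eq) (sym (lookup-index (xs⊆ys (∈-lookup j))))))

  map-unique-on : {B : Set} (f : A → B) {xs : List A} → Unique xs →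
    (∀ {x y} → x ∈ˡ xs → y ∈ˡ xs → f x ≡ f y → x ≡ y) → Unique (List.map f xs)
  map-unique-on f []      inj = []
  map-unique-on f (p ∷ u) inj =
    All.tabulate (λ fy∈ fx≡ → case ∈-map⁻ f fy∈ of λ where
      (y , y∈ , refl) → All.lookup p y∈ (inj (here refl) (there y∈) fx≡))
    ∷ map-unique-on f u (λ x∈ y∈ → inj (there x∈) (there y∈))

length-cartesianProductWith : {A B C : Set} (f : A → B → C) (xs : List A) (ys : List B) →
  length (cartesianProductWith f xs ys) ≡ length xs * length ys
length-cartesianProductWith f []       ys = refl
length-cartesianProductWith f (x ∷ xs) ys = trans
  (List.length-++ (List.map (f x) ys))
  (cong₂ _+_ (List.length-map (f x) ys) (length-cartesianProductWith f xs ys))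

elements : Subset n → List (Fin n)
elements Vec.[]            = []
elements (inside  Vec.∷ s) = zero ∷ List.map suc (elements s)
elements (outside Vec.∷ s) = List.map suc (elements s)

length-elements : (s : Subset n) → length (elements s) ≡ ∣ s ∣
length-elements Vec.[]            = refl
length-elements (inside  Vec.∷ s) = cong suc (trans (List.length-map suc (elements s)) (length-elements s))
length-elements (outside Vec.∷ s) = trans (List.length-map suc (elements s)) (length-elements s)

elements-unique : (s : Subset n) → Unique (elements s)
elements-unique Vec.[]            = []
elements-unique (inside  Vec.∷ s) =
  All.tabulate (λ sx∈ 0≡ → case ∈-map⁻ suc sx∈ of λ where (_ , _ , refl) → Fin.0≢1+n 0≡)
  ∷ Unique.map⁺ Fin.suc-injective (elements-unique s)
elements-unique (outside Vec.∷ s) = Unique.map⁺ Fin.suc-injective (elements-unique s)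

∈-elements⁺ : {s : Subset n} {x : Fin n} → x ∈ s → x ∈ˡ elements s
∈-elements⁺ {s = inside  Vec.∷ s} Vec.here       = here refl
∈-elements⁺ {s = inside  Vec.∷ s} (Vec.there x∈) = there (∈-map⁺ suc (∈-elements⁺ x∈))
∈-elements⁺ {s = outside Vec.∷ s} (Vec.there x∈) = ∈-map⁺ suc (∈-elements⁺ x∈)

∈-elements⁻ : {s : Subset n} {x : Fin n} → x ∈ˡ elements s → x ∈ s
∈-elements⁻ {s = inside  Vec.∷ s} (here refl) = Vec.here
∈-elements⁻ {s = inside  Vec.∷ s} (there x∈)  with _ , y∈ , refl ← ∈-map⁻ suc x∈ = Vec.there (∈-elements⁻ y∈)
∈-elements⁻ {s = outside Vec.∷ s} x∈          with _ , y∈ , refl ← ∈-map⁻ suc x∈ = Vec.there (∈-elements⁻ y∈)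

∣∣≤length : {s : Subset n} {xs : List (Fin n)} → (∀ {x} → x ∈ s → x ∈ˡ xs) → ∣ s ∣ ≤ length xs
∣∣≤length {s = s} s⊆xs = subst (_≤ _) (length-elements s) (length-⊆ (elements-unique s) (s⊆xs ∘ ∈-elements⁻))

length≤∣∣ : {s : Subset n} {xs : List (Fin n)} → Unique xs → (∀ {x} → x ∈ˡ xs → x ∈ s) → length xs ≤ ∣ s ∣
length≤∣∣ {s = s} u xs⊆s = subst (_ ≤_) (length-elements s) (length-⊆ u (∈-elements⁺ ∘ xs⊆s))

∈-tabulate⁺ : {P : Fin n → Set} (P? : ∀ x → Dec (P x)) {x : Fin n} → P x → x ∈ Vec.tabulate (does ∘ P?)
∈-tabulate⁺ P? {x} px = Vec.lookup⇒[]= x _ (trans (Vec.lookup∘tabulate _ x) (dec-true (P? x) px))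

∈-tabulate⁻ : {P : Fin n → Set} (P? : ∀ x → Dec (P x)) {x : Fin n} → x ∈ Vec.tabulate (does ∘ P?) → P x
∈-tabulate⁻ P? {x} x∈ with P? x | trans (sym (Vec.lookup∘tabulate (does ∘ P?) x)) (Vec.[]=⇒lookup x∈)
... | yes px | _ = px
... | no _   | ()

∈-inNeighbours⁺ : (A : ArcSet n) {u v : Fin n} → Arc A u v → u ∈ inNeighbours A v
∈-inNeighbours⁺ A {u} a = Vec.lookup⇒[]= u _ (trans (Vec.lookup-map u _ A) (Vec.[]=⇒lookup a))

∈-inNeighbours⁻ : (A : ArcSet n) {u v : Fin n} → u ∈ inNeighbours A v → Arc A u v
∈-inNeighbours⁻ A {u} {v} u∈ = Vec.lookup⇒[]= v _ (trans (sym (Vec.lookup-map u _ A)) (Vec.[]=⇒lookup u∈))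

_∈?ˡ_ : (x : Fin n) (xs : List (Fin n)) → Dec (x ∈ˡ xs)
_∈?ˡ_ = DecMembership._∈?_ Fin._≟_

arc? : (A : ArcSet n) → ∀ u v → Dec (Arc A u v)
arc? A u v = v Subset.∈? outNeighbours A u

-- Out-trees given by parent functions

record OutTree (D : Digraph n) : Set₁ where
  field
    V        : Fin n → Set
    V?       : ∀ v → Dec (V v)
    root     : Fin n
    root∈V   : V root
    parent   : Fin n → Fin n
    -- A certificate of acyclicity and of reachability from the root. It need not be the depth, so a
    -- rearranged tree may bring any convenient ranking.
    rank     : Fin n → ℕ
    parent∈V    : ∀ {v} → V v → v ≢ root → V (parent v)
    parent-arc  : ∀ {v} → V v → v ≢ root → Arc (arcs D) (parent v) v
    parent-rank : ∀ {v} → V v → v ≢ root → rank (parent v) < rank v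

  Child : Fin n → Fin n → Set
  Child u v = V v × v ≢ root × parent v ≡ u

  child? : ∀ u v → Dec (Child u v)
  child? u v = V? v ×-dec ¬? (v Fin.≟ root) ×-dec (parent v Fin.≟ u)

  Leaf : Fin n → Set
  Leaf v = V v × ¬ (∃[ w ] Child v w)

  leaf? : ∀ v → Dec (Leaf v)
  leaf? v = V? v ×-dec ¬? (Fin.any? (child? v))

  child-rank : ∀ {u v} → Child u v → rank u < rank v
  child-rank (v∈ , v≢ , refl) = parent-rank v∈ v≢

  arcSet : ArcSet n
  arcSet = Vec.tabulate λ u → Vec.tabulate (does ∘ child? u)

  arc⁺ : ∀ {u v} → Child u v → Arc arcSet u v
  arc⁺ {u} {v} c = subst (v ∈_) (sym (Vec.lookup∘tabulate _ u)) (∈-tabulate⁺ (child? u) c)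

  arc⁻ : ∀ {u v} → Arc arcSet u v → Child u v
  arc⁻ {u} {v} a = ∈-tabulate⁻ (child? u) (subst (v ∈_) (Vec.lookup∘tabulate _ u) a)

  subgraph : Subgraph n
  subgraph = Vec.tabulate (does ∘ V?) , arcSet

  connected-root : ∀ k v → rank v ≤ k → V v → EqClosure (Arc arcSet) root v
  connected-root k v v≤k v∈ with v Fin.≟ root
  ... | yes refl = ε
  connected-root zero    v v≤k v∈ | no v≢ = contradiction (ℕ.<-≤-trans (parent-rank v∈ v≢) v≤k) ℕ.n≮0
  connected-root (suc k) v v≤k v∈ | no v≢ =
    connected-root k (parent v) (s≤s⁻¹ (ℕ.<-≤-trans (parent-rank v∈ v≢) v≤k)) (parent∈V v∈ v≢)
    ◅◅ fwd (arc⁺ (v∈ , v≢ , refl)) ◅ ε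

  -- In a closed walk without backtracking, a step away from the root can
  -- only be followed by another one, so ranks increase from there on.
  descend : ∀ a b ys z → Child a b → Linked (Adjacent arcSet) (b ∷ ys ∷ʳ z) →
    Unique (a ∷ b ∷ ys) → All (z ≢_) (b ∷ ys) → (ys ≡ [] → a ≢ z) →
    rank a < rank z × parent z ∈ˡ b ∷ ys
  descend a b [] z ab (fwd bz ∷ _) _ _ _ =
    ℕ.<-trans (child-rank ab) (child-rank (arc⁻ bz)) , here (proj₂ (proj₂ (arc⁻ bz)))
  descend a b [] z (_ , _ , b→a) (bwd zb ∷ _) _ _ a≢z =
    contradiction (trans (sym b→a) (proj₂ (proj₂ (arc⁻ zb)))) (a≢z refl)
  descend a b (c ∷ ys) z ab (fwd bc ∷ walk) (_ ∷ u) (z≢b ∷ z∉) _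
    with c<z , z→ ← descend b c ys z (arc⁻ bc) walk u z∉ (λ _ → z≢b ∘ sym) =
    ℕ.<-trans (child-rank ab) c<z , there z→
  descend a b (c ∷ ys) z (_ , _ , b→a) (bwd cb ∷ _) ((_ ∷ a≢c ∷ _) ∷ _) _ _ =
    contradiction (trans (sym b→a) (proj₂ (proj₂ (arc⁻ cb)))) a≢c

  -- The walk climbs either all the way to `z` or up to its only turn, after which `descend`
  -- applies.
  ascend : ∀ a b ys z → Child b a → Linked (Adjacent arcSet) (b ∷ ys ∷ʳ z) →
    Unique (b ∷ ys) → All (z ≢_) (b ∷ ys) → rank z < rank a ⊎ parent z ∈ˡ b ∷ ys
  ascend a b [] z ba (fwd bz ∷ _) _ _ = inj₂ (here (proj₂ (proj₂ (arc⁻ bz))))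
  ascend a b [] z ba (bwd zb ∷ _) _ _ = inj₁ (ℕ.<-trans (child-rank (arc⁻ zb)) (child-rank ba))
  ascend a b (c ∷ ys) z ba (fwd bc ∷ walk) u (z≢b ∷ z∉) =
    inj₂ (there (proj₂ (descend b c ys z (arc⁻ bc) walk u z∉ (λ _ → z≢b ∘ sym))))
  ascend a b (c ∷ ys) z ba (bwd cb ∷ walk) (_ ∷ u) (z≢b ∷ z∉)
    with ascend b c ys z (arc⁻ cb) walk u z∉
  ... | inj₁ z<b = inj₁ (ℕ.<-trans z<b (child-rank ba))
  ... | inj₂ z→  = inj₂ (there z→)

  -- If the first step leads away from the root, `descend` makes the rank of `x` exceed itself. If
  -- it leads to the parent `y`, the rest of the cycle either leaves `x` ranked below `y` or
  -- contains the parent of `x`, so that `y` occurs twice.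
  acyclic : Acyclic arcSet
  acyclic (x ∷ y ∷ z ∷ zs) (_ , u@(x∉ ∷ _) , fwd xy ∷ walk) =
    ℕ.<-irrefl refl (proj₁ (descend x y (z ∷ zs) x (arc⁻ xy) walk u x∉ λ ()))
  acyclic (x ∷ y ∷ z ∷ zs) (_ , (_ ∷ x∉) ∷ (y∉ ∷ u) , bwd yx ∷ fwd yz ∷ walk) =
    contradiction refl (All.lookup y∉ (subst (_∈ˡ z ∷ zs) (proj₂ (proj₂ (arc⁻ yx)))
      (proj₂ (descend y z zs x (arc⁻ yz) walk (y∉ ∷ u) x∉ λ _ y≡x → ℕ.<-irrefl (cong rank y≡x) (child-rank (arc⁻ yx))))))
  acyclic (x ∷ y ∷ z ∷ zs) (_ , (_ ∷ x∉) ∷ (y∉ ∷ u) , bwd yx ∷ bwd zy ∷ walk)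
    with ascend y z zs x (arc⁻ zy) walk u x∉
  ... | inj₁ x<y = ℕ.<-asym x<y (child-rank (arc⁻ yx))
  ... | inj₂ x→  = contradiction refl (All.lookup y∉ (subst (_∈ˡ z ∷ zs) (proj₂ (proj₂ (arc⁻ yx))) x→))
  acyclic (_ ∷ [])     (s≤s () , _)
  acyclic (_ ∷ _ ∷ []) (s≤s (s≤s ()) , _)

  isOutTree : IsOutTree D subgraph
  isOutTree = record
    { isSubgraph = record
      { arcs⊆ = λ u v a → case arc⁻ a of λ where (v∈ , v≢ , refl) → parent-arc v∈ v≢
      ; ends  = λ u v a → case arc⁻ a of λ where
          (v∈ , v≢ , refl) → ∈-tabulate⁺ V? (parent∈V v∈ v≢) , ∈-tabulate⁺ V? v∈
      }
    ; isTree = record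
      { nonempty  = root , ∈-tabulate⁺ V? root∈V
      ; connected = λ u v u∈ v∈ →
          Eq.symmetric _ (connected-root _ u ℕ.≤-refl (∈-tabulate⁻ V? u∈))
          ◅◅ connected-root _ v ℕ.≤-refl (∈-tabulate⁻ V? v∈)
      ; acyclic   = acyclic
      }
    ; rooted = root , ∈-tabulate⁺ V? root∈V
        , ℕ.n≤0⇒n≡0 (∣∣≤length {xs = []} λ u∈ → contradiction refl (proj₁ (proj₂ (arc⁻ (∈-inNeighbours⁻ arcSet u∈)))))
        , λ v v∈ v≢ → ℕ.≤-antisym
            (∣∣≤length {xs = [ parent v ]} λ u∈ → here (sym (proj₂ (proj₂ (arc⁻ (∈-inNeighbours⁻ arcSet u∈))))))
            (length≤∣∣ {xs = [ parent v ]} ([] ∷ []) λ where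
              (here refl) → ∈-inNeighbours⁺ arcSet (arc⁺ (∈-tabulate⁻ V? v∈ , v≢ , refl)))
    }

  leaves≤ℓ : ∀ {xs} → Unique xs → (∀ {x} → x ∈ˡ xs → Leaf x) → length xs ≤ ℓ D
  leaves≤ℓ u leaf = ℕ.≤-trans
    (length≤∣∣ u λ x∈ → let v∈ , childless = leaf x∈ in
      ∈-tabulate⁺ (λ v → (v Subset.∈? proj₁ subgraph) ×-dec (outDegree arcSet v ℕ.≟ 0))
        ( ∈-tabulate⁺ V? v∈
        , ℕ.n≤0⇒n≡0 (∣∣≤length {xs = []} λ w∈ → contradiction (_ , arc⁻ w∈) childless)))
    (ℓ-upper D subgraph isOutTree)

  -- Every inner vertex has a child outside xs, so
  -- |leaves| + |inner vertices| = |V| ≥ 1 + |xs| + |inner vertices|.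
  siblings<ℓ : ∀ {xs} → Unique xs →
    (∀ {x} → x ∈ˡ xs → V x × x ≢ root × ∃[ y ] Child (parent x) y × y ∉ˡ xs) → length xs < ℓ D
  siblings<ℓ {xs} u sibling = ℕ.≤-trans
    (ℕ.+-cancelʳ-≤ (length inner) (suc (length xs)) (length outer) (begin
      suc (length xs) + length inner ≤⟨ ℕ.+-monoʳ-≤ (suc (length xs)) inner≤rest ⟩
      suc (length xs) + length rest  ≡⟨ List.length-++ (root ∷ xs) ⟨
      length ((root ∷ xs) ++ rest)   ≤⟨ length-⊆ unique-all all⊆ ⟩
      length (outer ++ inner)        ≡⟨ List.length-++ outer ⟩
      length outer + length inner    ∎))
    (leaves≤ℓ (Unique.filter⁺ leaf? (Unique.allFin⁺ n)) (proj₂ ∘ ∈-filter⁻ leaf? {xs = allFin n}))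
    where
    open ℕ.≤-Reasoning
    inner? = λ v → V? v ×-dec ¬? (leaf? v)
    rest?  = λ v → V? v ×-dec ¬? (v Fin.≟ root) ×-dec ¬? (v ∈?ˡ xs)
    outer = filter leaf? (allFin n)
    inner = filter inner? (allFin n)
    rest  = filter rest? (allFin n)

    inner⊆ : ∀ {v} → v ∈ˡ inner → v ∈ˡ List.map parent rest
    inner⊆ {v} v∈ with proj₂ (∈-filter⁻ inner? {xs = allFin n} v∈)
    ... | v∈V , ¬leaf with Fin.any? (λ w → child? v w ×-dec rest? w)
    ...   | yes (w , (_ , _ , refl) , w∈) = ∈-map⁺ parent (∈-filter⁺ rest? (∈-allFin w) w∈)
    ...   | no none = contradiction (v∈V , childless) ¬leaf
      where
      childless : ¬ (∃[ w ] Child v w)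
      childless (w , c@(w∈ , w≢ , refl)) with w ∈?ˡ xs
      ... | no w∉ = none (w , c , w∈ , w≢ , w∉)
      ... | yes w∈xs with y , y-child@(y∈ , y≢ , _) , y∉ ← proj₂ (proj₂ (sibling w∈xs)) =
        none (y , y-child , y∈ , y≢ , y∉)

    inner≤rest : length inner ≤ length rest
    inner≤rest = subst (length inner ≤_) (List.length-map parent rest)
      (length-⊆ (Unique.filter⁺ inner? (Unique.allFin⁺ n)) inner⊆)

    unique-all : Unique ((root ∷ xs) ++ rest)
    unique-all = Unique.++⁺
      (All.tabulate (λ x∈ root≡x → proj₁ (proj₂ (sibling x∈)) (sym root≡x)) ∷ u)
      (Unique.filter⁺ rest? (Unique.allFin⁺ n))
      λ where
        (here refl , x∈rest) → proj₁ (proj₂ (proj₂ (∈-filter⁻ rest? {xs = allFin n} x∈rest))) refl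
        (there x∈  , x∈rest) → proj₂ (proj₂ (proj₂ (∈-filter⁻ rest? {xs = allFin n} x∈rest))) x∈

    sort : ∀ {v} → V v → v ∈ˡ outer ++ inner
    sort {v} v∈ with leaf? v
    ... | yes leaf = ∈-++⁺ˡ (∈-filter⁺ leaf? (∈-allFin v) leaf)
    ... | no ¬leaf = ∈-++⁺ʳ outer (∈-filter⁺ inner? (∈-allFin v) (v∈ , ¬leaf))

    all⊆ : ∀ {v} → v ∈ˡ (root ∷ xs) ++ rest → v ∈ˡ outer ++ inner
    all⊆ v∈ with ∈-++⁻ (root ∷ xs) v∈
    ... | inj₁ (here refl) = sort root∈V
    ... | inj₁ (there x∈)  = sort (proj₁ (sibling x∈))
    ... | inj₂ x∈          = sort (proj₁ (proj₂ (∈-filter⁻ rest? {xs = allFin n} x∈)))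

-- Extending an out-tree by a path

<-upper-bound : (f : Fin n → ℕ) → ∃[ M ] ∀ v → f v < M
<-upper-bound {zero}  f = 0 , λ ()
<-upper-bound {suc n} f with M , f<M ← <-upper-bound (f ∘ suc) = suc (f zero) ⊔ M , λ where
  zero    → ℕ.m≤m⊔n _ M
  (suc v) → ℕ.<-≤-trans (f<M v) (ℕ.m≤n⊔m _ M)

module Selection (R : ℕ → ℕ → Set) (R? : ∀ i t → Dec (R i t)) where

  Marked : (ℕ → Bool) → ℕ → Set
  Marked f t = ∃[ i ] i < suc t × f i ≡ false × R i t

  marked? : ∀ f t → Dec (Marked f t)
  marked? f t = ℕ.anyUpTo? (λ i → (f i Bool.≟ false) ×-dec R? i t) (suc t)

  next : (ℕ → Bool) → ℕ → Bool
  next f zero    = false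
  next f (suc t) = not (f t) ∧ does (marked? f t)

  -- Course-of-values recursion: the decision at an index consults all earlier ones, so `table t`
  -- records those below `t` and is `false` elsewhere.
  table : ℕ → ℕ → Bool
  table zero    i = false
  table (suc t) i with i ℕ.≟ t
  ... | yes _ = next (table t) t
  ... | no _  = table t i

  selected : ℕ → Bool
  selected t = next (table t) t

  table-selected : ∀ {t i} → i < t → table t i ≡ selected i
  table-selected {suc t} {i} i<1+t with i ℕ.≟ t
  ... | yes refl = refl
  ... | no i≢t   = table-selected (ℕ.≤∧≢⇒< (s≤s⁻¹ i<1+t) i≢t)

  selected-suc⁻ : ∀ t → selected (suc t) ≡ true → selected t ≡ false × Marked selected t
  selected-suc⁻ t eq with table (suc t) t | table-selected (ℕ.n<1+n t) | marked? (table (suc t)) t | eq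
  ... | false | e | yes (i , i≤t , f , r) | _ =
    sym e , i , i≤t , trans (sym (table-selected i≤t)) f , r

  selected-suc⁺ : ∀ t → selected t ≡ false → Marked selected t → selected (suc t) ≡ true
  selected-suc⁺ t e (i , i≤t , f , r)
    with table (suc t) t | table-selected (ℕ.n<1+n t) | marked? (table (suc t)) t
  ... | false | _ | yes _ = refl
  ... | false | _ | no ¬m = contradiction (i , i≤t , trans (table-selected i≤t) f , r) ¬m
  ... | true  | e′ | _    = contradiction (trans e′ e) λ ()

-- A path z₀ → z₁ → … outside an out-tree T each of whose vertices zᵢ has
-- an in-neighbour qᵢ in T or at least two steps ahead of it.  In the new
-- tree the parent of zᵢ is qᵢ, except for an independent set of indices,
-- for which it is zᵢ₋₁; the index t + 1 is put into this set when t is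
-- not in it and zₜ already has a child.  Then t or t + 1 is in the set or
-- zₜ is a leaf; and there are more leaves than vertices with a sibling.
module Extension {D : Digraph n} (T : OutTree D) (l : ℕ) (z q : ℕ → Fin n)
  (z∉V   : ∀ {i} → i < l → ¬ OutTree.V T (z i))
  (z-inj : ∀ {i j} → i < l → j < l → z i ≡ z j → i ≡ j)
  (z-arc : ∀ {i} → suc i < l → Arc (arcs D) (z i) (z (suc i)))
  (q-arc : ∀ {i} → i < l → Arc (arcs D) (q i) (z i))
  (q-pos : ∀ {i} → i < l → OutTree.V T (q i) ⊎ ∃[ j ] 2 + i ≤ j × j < l × q i ≡ z j)
  where

  open OutTree T
  open Selection (λ i t → q i ≡ z t) (λ i t → q i Fin.≟ z t)

  OnPath : Fin n → Set
  OnPath v = ∃[ i ] i < l × v ≡ z i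

  onPath? : ∀ v → Dec (OnPath v)
  onPath? v = ℕ.anyUpTo? (λ i → v Fin.≟ z i) l

  parentᶻ : ℕ → Fin n
  parentᶻ i = if selected i then z (pred i) else q i

  parent′ : Fin n → Fin n
  parent′ v with onPath? v
  ... | yes (i , _) = parentᶻ i
  ... | no _        = parent v

  parent′-z : ∀ {i} → i < l → parent′ (z i) ≡ parentᶻ i
  parent′-z {i} i<l with onPath? (z i)
  ... | yes (j , j<l , eq) = cong parentᶻ (z-inj j<l i<l (sym eq))
  ... | no ¬on             = contradiction (i , i<l , refl) ¬on

  parent′-V : ∀ {v} → V v → parent′ v ≡ parent v
  parent′-V {v} v∈ with onPath? v
  ... | yes (j , j<l , refl) = contradiction v∈ (z∉V j<l)
  ... | no _                 = refl

  M : ℕ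
  M = proj₁ (<-upper-bound rank)

  -- Each position is worth 2. A kept path arc goes one position back, to an unselected index, so
  -- the bonus of a selected index must exceed 2. A spare arc goes at least two positions ahead,
  -- possibly to a selected index, so the bonus must be less than 4. The summand `M` puts the path
  -- above all ranks of `T`.
  rankᶻ : ℕ → ℕ
  rankᶻ i = M + (if selected i then 3 + 2 * (l ∸ i) else 2 * (l ∸ i))

  rank′ : Fin n → ℕ
  rank′ v with onPath? v
  ... | yes (i , _) = rankᶻ i
  ... | no _        = rank v

  rank′-z : ∀ {i} → i < l → rank′ (z i) ≡ rankᶻ i
  rank′-z {i} i<l with onPath? (z i)
  ... | yes (j , j<l , eq) = cong rankᶻ (z-inj j<l i<l (sym eq))
  ... | no ¬on             = contradiction (i , i<l , refl) ¬on

  rank′-V : ∀ {v} → V v → rank′ v ≡ rank v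
  rank′-V {v} v∈ with onPath? v
  ... | yes (j , j<l , refl) = contradiction v∈ (z∉V j<l)
  ... | no _                 = refl

  rank′-V<M : ∀ {v} → V v → rank′ v < M
  rank′-V<M {v} v∈ = subst (_< M) (sym (rank′-V v∈)) (proj₂ (<-upper-bound rank) v)

  V′ : Fin n → Set
  V′ v = V v ⊎ OnPath v

  z≢root : ∀ {i} → i < l → z i ≢ root
  z≢root i<l eq = z∉V i<l (subst V (sym eq) root∈V)

  parentᶻ∈V′ : ∀ {i} → i < l → V′ (parentᶻ i)
  parentᶻ∈V′ {i} i<l with selected i
  ... | true  = inj₂ (pred i , ℕ.≤-<-trans ℕ.pred[n]≤n i<l , refl)
  ... | false with q-pos i<l
  ...   | inj₁ q∈V               = inj₁ q∈V
  ...   | inj₂ (j , _ , j<l , e) = inj₂ (j , j<l , e)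

  parentᶻ-arc : ∀ {i} → i < l → Arc (arcs D) (parentᶻ i) (z i)
  parentᶻ-arc {zero}  i<l = q-arc i<l
  parentᶻ-arc {suc i} i<l with selected (suc i)
  ... | true  = z-arc i<l
  ... | false = q-arc i<l

  rankᶻ-ahead : ∀ {i j} → 2 + i ≤ j → j < l → rankᶻ j < M + 2 * (l ∸ i)
  rankᶻ-ahead {i} {j} 2+i≤j j<l = ℕ.+-monoʳ-< M (begin-strict
    (if selected j then 3 + 2 * (l ∸ j) else 2 * (l ∸ j)) ≤⟨ at-most-3 (selected j) ⟩
    3 + 2 * (l ∸ j)                                       <⟨ ℕ.≤-refl ⟩
    4 + 2 * (l ∸ j)                                       ≡⟨ ℕ.*-distribˡ-+ 2 2 (l ∸ j) ⟨
    2 * (2 + (l ∸ j))                                     ≤⟨ ℕ.*-monoʳ-≤ 2 gap ⟩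
    2 * (l ∸ i)                                           ∎)
    where
    open ℕ.≤-Reasoning
    at-most-3 : ∀ b → (if b then 3 + 2 * (l ∸ j) else 2 * (l ∸ j)) ≤ 3 + 2 * (l ∸ j)
    at-most-3 true  = ℕ.≤-refl
    at-most-3 false = ℕ.m≤n+m _ 3
    gap : 2 + (l ∸ j) ≤ l ∸ i
    gap = begin
      2 + (l ∸ j)       ≡⟨ ℕ.+-∸-assoc 2 (ℕ.<⇒≤ j<l) ⟨
      (2 + l) ∸ j       ≤⟨ ℕ.∸-monoʳ-≤ (2 + l) 2+i≤j ⟩
      (2 + l) ∸ (2 + i) ≡⟨⟩
      l ∸ i             ∎

  selected-pred : ∀ i → selected (suc i) ≡ true → selected i ≡ false
  selected-pred i = proj₁ ∘ selected-suc⁻ i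

  parentᶻ-rank : ∀ {i} → i < l → rank′ (parentᶻ i) < rankᶻ i
  parentᶻ-rank {i} i<l with selected i in sel
  parentᶻ-rank {zero}  i<l | true with () ← sel
  parentᶻ-rank {suc i} i<l | true rewrite rank′-z (ℕ.<⇒≤ i<l) | selected-pred i sel =
    ℕ.+-monoʳ-< M (begin-strict
      2 * (l ∸ i)           ≡⟨ cong (2 *_) (ℕ.+-∸-assoc 1 (ℕ.<⇒≤ i<l)) ⟩
      2 * suc (l ∸ suc i)   ≡⟨ ℕ.*-suc 2 (l ∸ suc i) ⟩
      2 + 2 * (l ∸ suc i)   <⟨ ℕ.≤-refl ⟩
      3 + 2 * (l ∸ suc i)   ∎)
    where open ℕ.≤-Reasoning
  parentᶻ-rank {i} i<l | false with q-pos i<l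
  ... | inj₁ q∈V = ℕ.<-≤-trans (rank′-V<M q∈V) (ℕ.m≤m+n M _)
  ... | inj₂ (j , 2+i≤j , j<l , q≡z) rewrite q≡z | rank′-z j<l = rankᶻ-ahead 2+i≤j j<l

  extended : OutTree D
  extended = record
    { V           = V′
    ; V?          = λ v → V? v ⊎-dec onPath? v
    ; root        = root
    ; root∈V      = inj₁ root∈V
    ; parent      = parent′
    ; rank        = rank′
    ; parent∈V    = λ where
        (inj₁ v∈)               v≢ → subst V′ (sym (parent′-V v∈)) (inj₁ (parent∈V v∈ v≢))
        (inj₂ (i , i<l , refl)) _  → subst V′ (sym (parent′-z i<l)) (parentᶻ∈V′ i<l)
    ; parent-arc  = λ where
        (inj₁ v∈)               v≢ → subst (λ u → Arc (arcs D) u _) (sym (parent′-V v∈)) (parent-arc v∈ v≢)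
        (inj₂ (i , i<l , refl)) _  → subst (λ u → Arc (arcs D) u _) (sym (parent′-z i<l)) (parentᶻ-arc i<l)
    ; parent-rank = λ where
        (inj₁ v∈)               v≢ → subst₂ _<_
          (sym (trans (cong rank′ (parent′-V v∈)) (rank′-V (parent∈V v∈ v≢)))) (sym (rank′-V v∈)) (parent-rank v∈ v≢)
        (inj₂ (i , i<l , refl)) _  → subst₂ _<_
          (cong rank′ (sym (parent′-z i<l))) (sym (rank′-z i<l)) (parentᶻ-rank i<l)
    }

  module T′ = OutTree extended

  parent′-selected : ∀ {i} → i < l → selected i ≡ true → parent′ (z i) ≡ z (pred i)
  parent′-selected i<l sel = trans (parent′-z i<l) (cong (if_then _ else _) sel)

  parent′-unselected : ∀ {i} → i < l → selected i ≡ false → parent′ (z i) ≡ q i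
  parent′-unselected i<l sel = trans (parent′-z i<l) (cong (if_then _ else _) sel)

  selected? : ∀ i → Dec (selected i ≡ true)
  selected? i = selected i Bool.≟ true

  chosen : List ℕ
  chosen = filter selected? (upTo l)

  chosen-leaves : List ℕ
  chosen-leaves = filter (T′.leaf? ∘ z) (upTo l)

  ∈-upTo-filter⁻ : {P : ℕ → Set} (P? : ∀ i → Dec (P i)) → ∀ {i} → i ∈ˡ filter P? (upTo l) → i < l × P i
  ∈-upTo-filter⁻ P? i∈ with i∈upTo , p ← ∈-filter⁻ P? {xs = upTo l} i∈ = ∈-upTo⁻ i∈upTo , p

  unique-z-filter : {P : ℕ → Set} (P? : ∀ i → Dec (P i)) → Unique (List.map z (filter P? (upTo l)))
  unique-z-filter P? = map-unique-on z (Unique.filter⁺ P? (Unique.upTo⁺ l))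
    λ i∈ j∈ → z-inj (proj₁ (∈-upTo-filter⁻ P? i∈)) (proj₁ (∈-upTo-filter⁻ P? j∈))

  chosen-sibling : ∀ {v} → v ∈ˡ List.map z chosen →
    V′ v × v ≢ root × ∃[ w ] T′.Child (parent′ v) w × w ∉ˡ List.map z chosen
  chosen-sibling v∈ with ∈-map⁻ z v∈
  ... | i , i∈ , refl with ∈-upTo-filter⁻ selected? i∈
  ... | i<l , sel = inj₂ (i , i<l , refl) , z≢root i<l , sibling i i<l sel
    where
    sibling : ∀ i → i < l → selected i ≡ true →
      ∃[ w ] T′.Child (parent′ (z i)) w × w ∉ˡ List.map z chosen
    sibling (suc t) i<l sel with selected-suc⁻ t sel
    ... | _ , j , j≤t , unsel , q≡z =
      -- The unselected index `j` that caused the selection of `suc t` hangs on `z t` too.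
      z j , (inj₂ (j , j<l , refl) , z≢root j<l
            , trans (parent′-unselected j<l unsel) (trans q≡z (sym (parent′-selected i<l sel))))
          , λ zj∈ → case ∈-map⁻ z zj∈ of λ where
              (k , k∈ , eq) → let k<l , k-sel = ∈-upTo-filter⁻ selected? k∈ in
                case trans (sym unsel) (trans (cong selected (z-inj j<l k<l eq)) k-sel) of λ ()
      where j<l = ℕ.<-trans j≤t i<l

  -- When neither index is selected, `z t` has no child: vertices of `T` keep parents in `T`, a
  -- selected child would have index `suc t`, and an unselected child has a smaller index than `t`
  -- and would have caused the selection of `suc t`.
  trichotomy : ∀ {t} → suc t < l → selected (suc t) ≡ true ⊎ selected t ≡ true ⊎ T′.Leaf (z t)
  trichotomy {t} 1+t<l with selected (suc t) in sel′ | selected t in sel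
  ... | true  | _     = inj₁ refl
  ... | false | true  = inj₂ (inj₁ refl)
  ... | false | false = inj₂ (inj₂ (inj₂ (t , t<l , refl) , childless))
    where
    t<l = ℕ.<⇒≤ 1+t<l
    unmarked : ¬ Marked selected t
    unmarked m = case trans (sym sel′) (selected-suc⁺ t sel m) of λ ()
    childless : ¬ (∃[ w ] T′.Child (z t) w)
    childless (w , inj₁ w∈ , w≢ , eq) =
      z∉V t<l (subst V (trans (sym (parent′-V w∈)) eq) (parent∈V w∈ w≢))
    childless (_ , inj₂ (i , i<l , refl) , _ , eq) with selected i in sel-i
    childless (_ , inj₂ (zero , i<l , refl) , _ , eq) | true with () ← sel-i
    childless (_ , inj₂ (suc i , i<l , refl) , _ , eq) | true
      with refl ← z-inj (ℕ.<⇒≤ i<l) t<l (trans (sym (parent′-selected i<l sel-i)) eq) =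
      case trans (sym sel′) sel-i of λ ()
    childless (_ , inj₂ (i , i<l , refl) , _ , eq) | false
      with q≡z ← trans (sym (parent′-unselected i<l sel-i)) eq | q-pos i<l
    ... | inj₁ q∈V = z∉V t<l (subst V q≡z q∈V)
    ... | inj₂ (j , 2+i≤j , j<l , q≡zj) with refl ← z-inj j<l t<l (trans (sym q≡zj) q≡z) =
      unmarked (i , ℕ.≤-trans (ℕ.n≤1+n _) (ℕ.m≤n⇒m≤1+n 2+i≤j) , sel-i , q≡z)

  length-chosen<ℓ : length chosen < ℓ D
  length-chosen<ℓ = subst (_< ℓ D) (List.length-map z chosen)
    (T′.siblings<ℓ (unique-z-filter selected?) chosen-sibling)

  length-chosen-leaves≤ℓ : length chosen-leaves ≤ ℓ D
  length-chosen-leaves≤ℓ = subst (_≤ ℓ D) (List.length-map z chosen-leaves)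
    (T′.leaves≤ℓ (unique-z-filter (T′.leaf? ∘ z)) λ v∈ → case ∈-map⁻ z v∈ of λ where
      (_ , i∈ , refl) → proj₂ (∈-upTo-filter⁻ (T′.leaf? ∘ z) i∈))

  cover : ∀ {t} → t ∈ˡ upTo (pred l) → t ∈ˡ List.map pred chosen ++ chosen ++ chosen-leaves
  cover {t} t∈ with 1+t<l ← ℕ.pred-cancel-< (∈-upTo⁻ t∈) | trichotomy 1+t<l
  ... | inj₁ sel        = ∈-++⁺ˡ (∈-map⁺ pred (∈-filter⁺ selected? (∈-upTo⁺ 1+t<l) sel))
  ... | inj₂ (inj₁ sel) = ∈-++⁺ʳ (List.map pred chosen) (∈-++⁺ˡ (∈-filter⁺ selected? (∈-upTo⁺ (ℕ.<⇒≤ 1+t<l)) sel))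
  ... | inj₂ (inj₂ lf)  = ∈-++⁺ʳ (List.map pred chosen) (∈-++⁺ʳ chosen (∈-filter⁺ (T′.leaf? ∘ z) (∈-upTo⁺ (ℕ.<⇒≤ 1+t<l)) lf))

  -- By `trichotomy` the selected indices, their predecessors and the leaves cover all indices but
  -- the last; the strictness of `length-chosen<ℓ` pays for that one.
  length≤3ℓ : l ≤ 3 * ℓ D
  length≤3ℓ = begin
    l                                   ≤⟨ ℕ.m≤n+m∸n l 1 ⟩
    suc (pred l)                        ≡⟨ cong suc (List.length-upTo (pred l)) ⟨
    suc (length (upTo (pred l)))        ≤⟨ s≤s (length-⊆ (Unique.upTo⁺ (pred l)) cover) ⟩
    suc (length (List.map pred chosen ++ chosen ++ chosen-leaves))
                                        ≡⟨ cong suc (List.length-++ (List.map pred chosen)) ⟩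
    suc (length (List.map pred chosen)) + length (chosen ++ chosen-leaves)
                                        ≡⟨ cong₂ (λ a b → suc a + b) (List.length-map pred chosen) (List.length-++ chosen) ⟩
    suc (length chosen) + (length chosen + length chosen-leaves)
      ≤⟨ ℕ.+-mono-≤ length-chosen<ℓ (ℕ.+-mono-≤ (ℕ.<⇒≤ length-chosen<ℓ)
           (ℕ.≤-trans length-chosen-leaves≤ℓ (ℕ.m≤m+n (ℓ D) 0))) ⟩
    3 * ℓ D                             ∎
    where open ℕ.≤-Reasoning

-- Spare in-neighbours

avoid : (s : Subset n) (xs : List (Fin n)) → length xs < ∣ s ∣ → ∃[ x ] x ∈ s × x ∉ˡ xs
avoid s xs xs<s with Fin.any? (λ x → (x Subset.∈? s) ×-dec ¬? (x ∈?ˡ xs))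
... | yes found = found
... | no none   = contradiction xs<s (ℕ.≤⇒≯ (∣∣≤length λ {x} x∈ →
  decidable-stable (x ∈?ˡ xs) λ x∉ → none (x , x∈ , x∉)))

-- All that is used of the degree conditions. With in-degree 2 only `a` can be avoided by counting;
-- `c` is avoided by orientation, which requires the arc from `v` to `c`.
HasSpareInNeighbours : Digraph n → Set
HasSpareInNeighbours {n} D =
  (v a c : Fin n) → ∃[ q ] Arc (arcs D) q v × q ≢ a × (Arc (arcs D) v c → q ≢ c)

hasSpareInNeighbours : (D : Digraph n) → MinInDegree≥ 3 D ⊎ (IsOriented D × MinInDegree≥ 2 D) →
  HasSpareInNeighbours D
hasSpareInNeighbours D (inj₁ 3≤) v a c with avoid (inNeighbours (arcs D) v) (a ∷ c ∷ []) (3≤ v)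
... | q , q∈ , q∉ = q , ∈-inNeighbours⁻ (arcs D) q∈ , q∉ ∘ here , λ _ → q∉ ∘ there ∘ here
hasSpareInNeighbours D (inj₂ (oriented , 2≤)) v a c with avoid (inNeighbours (arcs D) v) [ a ] (2≤ v)
... | q , q∈ , q∉ = q , ∈-inNeighbours⁻ (arcs D) q∈ , q∉ ∘ here
                  , λ vc q≡c → oriented v q (subst (Arc (arcs D) v) (sym q≡c) vc) (∈-inNeighbours⁻ (arcs D) q∈)

least : {P : ℕ → Set} → (∀ i → Dec (P i)) → ∀ k → P k → ∃[ i ] P i × ∀ j → P j → i ≤ j
least P? zero    p = zero , p , λ _ _ → z≤n
least P? (suc k) p with P? zero
... | yes p₀ = zero , p₀ , λ _ _ → z≤n
... | no ¬p₀ with least (P? ∘ suc) k p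
...   | i , pᵢ , minimal = suc i , pᵢ , λ where
  zero    p₀ → contradiction p₀ ¬p₀
  (suc j) pⱼ → s≤s (minimal j pⱼ)

-- The predicate is not tested at `0`, since no part of a path precedes the index `0`.
last-or-zero : {P : ℕ → Set} → (∀ i → Dec (P i)) → ∀ m →
  ∃[ s ] s ≤ m × (s ≡ 0 ⊎ P s) × ∀ i → s < i → i ≤ m → ¬ P i
last-or-zero P? zero = zero , z≤n , inj₁ refl , λ i 0<i i≤0 → contradiction (ℕ.<-≤-trans 0<i i≤0) ℕ.n≮0
last-or-zero P? (suc m) with P? (suc m)
... | yes p = suc m , ℕ.≤-refl , inj₂ p , λ i m<i i≤m → contradiction i≤m (ℕ.<⇒≱ m<i)
... | no ¬p with last-or-zero P? m
...   | s , s≤m , ps , none = s , ℕ.m≤n⇒m≤1+n s≤m , ps , λ i s<i i≤1+m → case ℕ.m≤n⇒m<n∨m≡n i≤1+m of λ where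
  (inj₁ i<1+m) → none i s<i (s≤s⁻¹ i<1+m)
  (inj₂ refl)  → ¬p

-- Shortest walks and breadth-first out-branchings

module _ (A : ArcSet n) (r : Fin n) where

  Walk : ℕ → Fin n → Set
  Walk zero    v = v ≡ r
  Walk (suc k) v = ∃[ u ] Arc A u v × Walk k u

  walk? : ∀ k v → Dec (Walk k v)
  walk? zero    v = v Fin.≟ r
  walk? (suc k) v = Fin.any? λ u → arc? A u v ×-dec walk? k u

walk-⊆ : {A B : ArcSet n} {r : Fin n} → (∀ u v → Arc A u v → Arc B u v) →
  ∀ k {v} → Walk A r k v → Walk B r k v
walk-⊆ A⊆B zero    eq          = eq
walk-⊆ A⊆B (suc k) (u , a , w) = u , A⊆B u _ a , walk-⊆ A⊆B k w

-- Entering a reached vertex backwards leads to its only in-neighbour,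
-- which precedes it on the walk that reaches it.
branching-walks : (D : Digraph n) → HasOutBranching D → ∃[ r ] ∀ v → ∃[ k ] Walk (arcs D) r k v
branching-walks {n} D ((V , A) , tree , spanning) with IsOutTree.rooted tree
... | r , r∈ , r-in , in≡1 = r , λ v →
  let k , w = follow (IsTree.connected (IsOutTree.isTree tree) r v r∈ (spanning v)) 0 refl
  in  k , walk-⊆ (IsSubgraph.arcs⊆ (IsOutTree.isSubgraph tree)) k w
  where
  no-arc-into-r : ∀ {u} → ¬ Arc A u r
  no-arc-into-r {u} a = contradiction
    (subst (1 ≤_) r-in (length≤∣∣ {xs = [ u ]} ([] ∷ []) λ where (here refl) → ∈-inNeighbours⁺ A a)) ℕ.n≮0

  tail-unique : ∀ {u u′ v} → Arc A u v → Arc A u′ v → u ≡ u′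
  tail-unique {u} {u′} {v} a a′ with v Fin.≟ r | u Fin.≟ u′
  ... | _        | yes u≡u′ = u≡u′
  ... | yes refl | _        = contradiction a no-arc-into-r
  ... | no v≢r   | no u≢u′  = contradiction
    (subst (2 ≤_) (in≡1 v (spanning v) v≢r) (length≤∣∣ {xs = u ∷ u′ ∷ []} ((u≢u′ ∷ []) ∷ [] ∷ []) λ where
      (here refl)         → ∈-inNeighbours⁺ A a
      (there (here refl)) → ∈-inNeighbours⁺ A a′))
    (ℕ.<-irrefl refl)

  follow : ∀ {u v} → EqClosure (Arc A) u v → ∀ k → Walk A r k u → ∃[ k′ ] Walk A r k′ v
  follow ε            k       w            = k , w
  follow (fwd a ◅ as) k       w            = follow as (suc k) (_ , a , w)
  follow (bwd a ◅ as) zero    refl         = contradiction a no-arc-into-r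
  follow (bwd a ◅ as) (suc k) (_ , a′ , w) = follow as k (subst (Walk A r k) (tail-unique a′ a) w)

-- No arc of `D` skips a level downwards. As ranks increase along tree arcs, each tree arc raises
-- the rank by exactly one.
record IsBreadthFirst {D : Digraph n} (T : OutTree D) : Set where
  open OutTree T
  field
    spanning : ∀ v → V v
    arc-rank : ∀ {u v} → Arc (arcs D) u v → rank v ≤ suc (rank u)

breadthFirst : (D : Digraph n) (r : Fin n) → (∀ v → ∃[ k ] Walk (arcs D) r k v) →
  ∃[ T ] IsBreadthFirst {D = D} T
breadthFirst {n} D r reach = record
  { V           = λ _ → ⊤
  ; V?          = λ _ → yes tt
  ; root        = r
  ; root∈V      = tt
  ; parent      = parent
  ; rank        = dist
  ; parent∈V    = λ _ _ → tt
  ; parent-arc  = λ {v} _ v≢ → proj₁ (parent-spec v≢)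
  ; parent-rank = λ {v} _ v≢ → proj₂ (parent-spec v≢)
  } , record { spanning = λ _ → tt ; arc-rank = λ {u} a → minimal _ _ (u , a , shortest u) }
  where
  shortest-walk : ∀ v → ∃[ k ] Walk (arcs D) r k v × ∀ j → Walk (arcs D) r j v → k ≤ j
  shortest-walk v = least (λ k → walk? (arcs D) r k v) (proj₁ (reach v)) (proj₂ (reach v))

  dist : Fin n → ℕ
  dist v = proj₁ (shortest-walk v)

  shortest : ∀ v → Walk (arcs D) r (dist v) v
  shortest v = proj₁ (proj₂ (shortest-walk v))

  minimal : ∀ v j → Walk (arcs D) r j v → dist v ≤ j
  minimal v = proj₂ (proj₂ (shortest-walk v))

  previous : ∀ k v → Walk (arcs D) r k v → Fin n
  previous zero    v _       = r
  previous (suc k) v (u , _) = u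

  parent : Fin n → Fin n
  parent v = previous (dist v) v (shortest v)

  parent-spec : ∀ {v} → v ≢ r → Arc (arcs D) (parent v) v × dist (parent v) < dist v
  parent-spec {v} v≢ with dist v | shortest v
  ... | zero  | v≡r         = contradiction v≡r v≢
  ... | suc k | (u , a , w) = a , s≤s (minimal u k w)

-- Descendants and paths of only children

module Descendants {D : Digraph n} (T : OutTree D) (spanning : ∀ v → OutTree.V T v) where

  open OutTree T

  -- The condition in `below` keeps the meaningless parent of the root out of play.
  data Desc (a : Fin n) : Fin n → Set where
    self  : Desc a a
    below : ∀ {v} → v ≢ root → Desc a (parent v) → Desc a v

  desc?-bounded : ∀ k a v → rank v ≤ k → Dec (Desc a v)
  desc?-bounded k a v v≤k with v Fin.≟ a | v Fin.≟ root
  ... | yes refl | _        = yes self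
  ... | no v≢a   | yes v≡r  = no λ where
    self          → v≢a refl
    (below v≢r _) → v≢r v≡r
  desc?-bounded zero    a v v≤k | no v≢a | no v≢r =
    contradiction (ℕ.<-≤-trans (parent-rank (spanning v) v≢r) v≤k) ℕ.n≮0
  desc?-bounded (suc k) a v v≤k | no v≢a | no v≢r =
    map′ (below v≢r) (λ where self → contradiction refl v≢a ; (below _ d) → d)
      (desc?-bounded k a (parent v) (s≤s⁻¹ (ℕ.<-≤-trans (parent-rank (spanning v) v≢r) v≤k)))

  desc? : ∀ a v → Dec (Desc a v)
  desc? a v = desc?-bounded (rank v) a v ℕ.≤-refl

  desc-rank : ∀ {a v} → Desc a v → rank a ≤ rank v
  desc-rank self        = ℕ.≤-refl
  desc-rank (below v≢ d) = ℕ.≤-trans (desc-rank d) (ℕ.<⇒≤ (parent-rank (spanning _) v≢))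

  desc-trans : ∀ {a b v} → Desc a b → Desc b v → Desc a v
  desc-trans ab self         = ab
  desc-trans ab (below v≢ d) = below v≢ (desc-trans ab d)

  desc-child : ∀ {a u v} → Child u v → Desc a u → Desc a v
  desc-child (_ , v≢ , refl) d = below v≢ d

  subtree : Fin n → OutTree D
  subtree a = record
    { V           = Desc a
    ; V?          = desc? a
    ; root        = a
    ; root∈V      = self
    ; parent      = parent
    ; rank        = rank
    ; parent∈V    = λ where
        self        a≢a → contradiction refl a≢a
        (below _ d) _   → d
    ; parent-arc  = λ where
        self         a≢a → contradiction refl a≢a
        (below v≢ _) _   → parent-arc (spanning _) v≢
    ; parent-rank = λ where
        self         a≢a → contradiction refl a≢a
        (below v≢ _) _   → parent-rank (spanning _) v≢
    }

  OnlyChild : Fin n → Fin n → Set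
  OnlyChild u v = Child u v × ∀ w → Child u w → w ≡ v

  Unary : Fin n → Set
  Unary u = ∃[ v ] OnlyChild u v

  unary? : ∀ u → Dec (Unary u)
  unary? u = Fin.any? λ v → child? u v ×-dec Fin.all? λ w → child? u w →-dec (w Fin.≟ v)

-- The breadth-first property leaves two kinds of spare in-neighbours of
-- an inner vertex xᵢ of the path: descendants of xᵢ₊₂ and vertices which
-- are not descendants of x₀.  Let s be the last index of the second kind.
-- Then x₁, …, xₛ₋₁ extend the rest of the tree, with xₛ moved to its
-- spare in-neighbour, and xₛ₊₁, …, xₘ extend the subtree at xₘ₊₁.
module UnaryPath {D : Digraph n} (T : OutTree D) (bfs : IsBreadthFirst T) (spare : HasSpareInNeighbours D)
  (x : ℕ → Fin n) (m : ℕ)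
  (path : ∀ {i} → i ≤ m → Descendants.OnlyChild T (IsBreadthFirst.spanning bfs) (x i) (x (suc i)))
  where

  open OutTree T
  open IsBreadthFirst bfs
  open Descendants T spanning

  x-arc : ∀ {i} → i ≤ m → Arc (arcs D) (x i) (x (suc i))
  x-arc i≤m with path i≤m
  ... | (_ , v≢ , p) , _ = subst (λ u → Arc (arcs D) u _) p (parent-arc (spanning _) v≢)

  x-rank : ∀ {i} → i ≤ suc m → rank (x i) ≡ i + rank (x 0)
  x-rank {zero}  _     = refl
  x-rank {suc i} 1+i≤m = trans
    (ℕ.≤-antisym (arc-rank (x-arc (s≤s⁻¹ 1+i≤m))) (child-rank (proj₁ (path (s≤s⁻¹ 1+i≤m)))))
    (cong suc (x-rank (ℕ.<⇒≤ 1+i≤m)))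

  x-rank-≤ : ∀ {i j} c → i ≤ suc m → j ≤ suc m → rank (x i) ≤ c + rank (x j) → i ≤ c + j
  x-rank-≤ {i} {j} c i≤ j≤ le = ℕ.+-cancelʳ-≤ (rank (x 0)) i (c + j)
    (subst₂ _≤_ (x-rank i≤) (trans (cong (c +_) (x-rank j≤)) (sym (ℕ.+-assoc c j _))) le)

  x-inj : ∀ {i j} → i ≤ suc m → j ≤ suc m → x i ≡ x j → i ≡ j
  x-inj i≤ j≤ eq = ℕ.≤-antisym
    (x-rank-≤ 0 i≤ j≤ (ℕ.≤-reflexive (cong rank eq))) (x-rank-≤ 0 j≤ i≤ (ℕ.≤-reflexive (cong rank (sym eq))))

  x-desc : ∀ {i} → i ≤ suc m → Desc (x 0) (x i)
  x-desc {zero}  _     = self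
  x-desc {suc i} 1+i≤m = desc-child (proj₁ (path (s≤s⁻¹ 1+i≤m))) (x-desc (ℕ.<⇒≤ 1+i≤m))

  x-not-below-end : ∀ {i} → i ≤ m → ¬ Desc (x (suc m)) (x i)
  x-not-below-end i≤m d = ℕ.<⇒≱ (s≤s i≤m) (x-rank-≤ 0 ℕ.≤-refl (ℕ.m≤n⇒m≤1+n i≤m) (desc-rank d))

  -- Only children leave no way off the path before its end `x (suc m)`.
  desc-split : ∀ {v} → Desc (x 0) v → (∃[ j ] j ≤ m × v ≡ x j) ⊎ Desc (x (suc m)) v
  desc-split self = inj₁ (0 , z≤n , refl)
  desc-split {v} (below v≢ d) with desc-split d
  ... | inj₂ d′ = inj₂ (below v≢ d′)
  ... | inj₁ (j , j≤m , p) with refl ← proj₂ (path j≤m) v (spanning v , v≢ , p) | ℕ.m≤n⇒m<n∨m≡n j≤m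
  ...   | inj₁ j<m  = inj₁ (suc j , j<m , refl)
  ...   | inj₂ refl = inj₂ self

  q : ℕ → Fin n
  q i = proj₁ (spare (x i) (x (pred i)) (x (suc i)))

  q-arc : ∀ i → Arc (arcs D) (q i) (x i)
  q-arc i = proj₁ (proj₂ (spare (x i) (x (pred i)) (x (suc i))))

  -- The breadth-first property gives j ≥ i - 1. The choice of `q i` excludes i - 1 and i + 1, and
  -- the absence of loops excludes i.
  q-split : ∀ {i} → i ≤ m → Desc (x 0) (q i) →
    (∃[ j ] 2 + i ≤ j × j ≤ m × q i ≡ x j) ⊎ Desc (x (suc m)) (q i)
  q-split {i} i≤m d with desc-split d
  ... | inj₂ d′ = inj₂ d′
  ... | inj₁ (j , j≤m , q≡x) = inj₁ (j , ℕ.≤∧≢⇒< i<j 1+i≢j , j≤m , q≡x)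
    where
    i≤1+j : i ≤ suc j
    i≤1+j = x-rank-≤ 1 (ℕ.m≤n⇒m≤1+n i≤m) (ℕ.m≤n⇒m≤1+n j≤m)
      (subst (λ u → rank (x i) ≤ suc (rank u)) q≡x (arc-rank (q-arc i)))
    i≢1+j : i ≢ suc j
    i≢1+j refl = proj₁ (proj₂ (proj₂ (spare (x i) (x (pred i)) (x (suc i))))) q≡x
    i≢j : i ≢ j
    i≢j refl = loopless D (x i) (subst (λ u → Arc (arcs D) u (x i)) q≡x (q-arc i))
    1+i≢j : suc i ≢ j
    1+i≢j refl = proj₂ (proj₂ (proj₂ (spare (x i) (x (pred i)) (x (suc i))))) (x-arc i≤m) q≡x
    i<j : i < j
    i<j = ℕ.≤∧≢⇒< (s≤s⁻¹ (ℕ.≤∧≢⇒< i≤1+j i≢1+j)) i≢j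

  upper≤3ℓ : ∀ s → s ≤ m → (∀ i → s < i → i ≤ m → Desc (x 0) (q i)) → m ∸ s ≤ 3 * ℓ D
  upper≤3ℓ s s≤m q-desc = Extension.length≤3ℓ (subtree (x (suc m))) (m ∸ s) (x ∘ shift) (q ∘ shift)
    (λ i< → x-not-below-end (shift≤m i<))
    (λ i< j< eq → ℕ.+-cancelˡ-≡ (suc s) _ _
      (x-inj (ℕ.m≤n⇒m≤1+n (shift≤m i<)) (ℕ.m≤n⇒m≤1+n (shift≤m j<)) eq))
    (λ {i} i< → subst (λ j → Arc (arcs D) (x (shift i)) (x j)) (sym (ℕ.+-suc (suc s) i))
      (x-arc (shift≤m (ℕ.<⇒≤ i<))))
    (λ {i} _ → q-arc (shift i))
    q-pos
    where
    shift : ℕ → ℕ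
    shift i = suc s + i
    shift≤m : ∀ {i} → i < m ∸ s → shift i ≤ m
    shift≤m {i} i< = subst₂ _≤_ (ℕ.+-suc s i) (ℕ.m+[n∸m]≡n s≤m) (ℕ.+-monoʳ-≤ s i<)
    q-pos : ∀ {i} → i < m ∸ s →
      Desc (x (suc m)) (q (shift i)) ⊎ ∃[ j ] 2 + i ≤ j × j < m ∸ s × q (shift i) ≡ x (shift j)
    q-pos {i} i< with q-split (shift≤m i<) (q-desc (shift i) (s≤s (ℕ.m≤m+n s i)) (shift≤m i<))
    ... | inj₂ d = inj₁ d
    ... | inj₁ (j , gap , j≤m , q≡x) with k , refl ← ℕ.m≤n⇒∃[o]m+o≡n gap =
      inj₂ (2 + i + k , ℕ.m≤m+n (2 + i) k
           , ℕ.+-cancelˡ-< s _ _ (subst₂ _≤_ eq (sym (ℕ.m+[n∸m]≡n s≤m)) j≤m)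
           , trans q≡x (cong x eq))
      where
      eq : 2 + shift i + k ≡ shift (2 + i + k)
      eq = solve 3 (λ s i k → con 2 :+ (con 1 :+ s :+ i) :+ k := con 1 :+ s :+ (con 2 :+ i :+ k)) refl s i k
        where open +-*-Solver

  -- Here `suc s` is the index whose vertex is moved, and x₁, ..., xₛ are torn out. As x₀ stays, so
  -- does the root of `T`, and moving `x (suc s)` to a non-descendant of x₀ keeps everything below
  -- it attached.
  module Lower (s : ℕ) (s<m : suc s ≤ m) (q-outside : ¬ Desc (x 0) (q (suc s))) where

    V₀ : Fin n → Set
    V₀ v = ¬ (∃[ i ] i < s × v ≡ x (suc i))

    bound : ∀ {i} → i < s → suc i ≤ suc m
    bound i<s = s≤s (ℕ.≤-trans (ℕ.<⇒≤ i<s) (ℕ.<⇒≤ s<m))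

    nondesc∈V₀ : ∀ {v} → ¬ Desc (x 0) v → V₀ v
    nondesc∈V₀ ¬d (i , i<s , refl) = ¬d (x-desc (bound i<s))

    parent₀ : Fin n → Fin n
    parent₀ v with v Fin.≟ x (suc s)
    ... | yes _ = q (suc s)
    ... | no _  = parent v

    parent₀-x : parent₀ (x (suc s)) ≡ q (suc s)
    parent₀-x with x (suc s) Fin.≟ x (suc s)
    ... | yes _  = refl
    ... | no x≢x = contradiction refl x≢x

    parent₀-other : ∀ {v} → v ≢ x (suc s) → parent₀ v ≡ parent v
    parent₀-other {v} v≢x with v Fin.≟ x (suc s)
    ... | yes v≡x = contradiction v≡x v≢x
    ... | no _    = refl

    -- The moved subtree is lifted by a constant above its new parent, which lies outside it and
    -- keeps its rank.
    rank₀ : Fin n → ℕ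
    rank₀ v with desc? (x (suc s)) v
    ... | yes _ = rank v + suc (rank (q (suc s)))
    ... | no _  = rank v

    rank₀-desc : ∀ {v} → Desc (x (suc s)) v → rank₀ v ≡ rank v + suc (rank (q (suc s)))
    rank₀-desc {v} d with desc? (x (suc s)) v
    ... | yes _ = refl
    ... | no ¬d = contradiction d ¬d

    rank₀-nondesc : ∀ {v} → ¬ Desc (x (suc s)) v → rank₀ v ≡ rank v
    rank₀-nondesc {v} ¬d with desc? (x (suc s)) v
    ... | yes d = contradiction d ¬d
    ... | no _  = refl

    remainder : OutTree D
    remainder = record
      { V           = V₀
      ; V?          = λ v → ¬? (ℕ.anyUpTo? (λ i → v Fin.≟ x (suc i)) s)
      ; root        = root
      ; root∈V      = λ (i , i<s , eq) → proj₁ (proj₂ (proj₁ (path (s≤s⁻¹ (bound i<s))))) (sym eq)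
      ; parent      = parent₀
      ; rank        = rank₀
      ; parent∈V    = parent₀∈V₀
      ; parent-arc  = parent₀-arc
      ; parent-rank = parent₀-rank
      }
      where
      parent₀∈V₀ : ∀ {v} → V₀ v → v ≢ root → V₀ (parent₀ v)
      parent₀∈V₀ {v} v∈ v≢ with v Fin.≟ x (suc s)
      ... | yes refl = nondesc∈V₀ q-outside
      -- A vertex whose parent was torn out is the next vertex of the path: torn out itself, or the
      -- moved `x (suc s)`.
      ... | no v≢x   = λ (i , i<s , p) →
        let v≡x = proj₂ (path (ℕ.≤-trans i<s (ℕ.<⇒≤ s<m))) v (spanning v , v≢ , p) in
        case ℕ.m≤n⇒m<n∨m≡n i<s of λ where
          (inj₁ 1+i<s) → v∈ (suc i , 1+i<s , v≡x)
          (inj₂ 1+i≡s) → v≢x (trans v≡x (cong (x ∘ suc) 1+i≡s))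

      parent₀-arc : ∀ {v} → V₀ v → v ≢ root → Arc (arcs D) (parent₀ v) v
      parent₀-arc {v} _ v≢ with v Fin.≟ x (suc s)
      ... | yes refl = q-arc (suc s)
      ... | no _     = parent-arc (spanning v) v≢

      rank₀-parent : ∀ {v} → v ≢ root → v ≢ x (suc s) → rank₀ (parent v) < rank₀ v
      rank₀-parent {v} v≢ v≢x = case desc? (x (suc s)) v of λ where
        (yes self)        → contradiction refl v≢x
        (yes (below _ d)) → subst₂ _<_ (sym (rank₀-desc d)) (sym (rank₀-desc (below v≢ d)))
          (ℕ.+-monoˡ-< _ (parent-rank (spanning v) v≢))
        (no ¬d)           → subst₂ _<_ (sym (rank₀-nondesc (¬d ∘ below v≢))) (sym (rank₀-nondesc ¬d))
          (parent-rank (spanning v) v≢)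

      rank₀-q : rank₀ (q (suc s)) < rank₀ (x (suc s))
      rank₀-q = subst₂ _<_
        (sym (rank₀-nondesc (q-outside ∘ desc-trans (x-desc (ℕ.m≤n⇒m≤1+n s<m))))) (sym (rank₀-desc self))
        (ℕ.m≤n+m _ (rank (x (suc s))))

      parent₀-rank : ∀ {v} → V₀ v → v ≢ root → rank₀ (parent₀ v) < rank₀ v
      parent₀-rank {v} _ v≢ = case v Fin.≟ x (suc s) of λ where
        (yes refl) → subst (λ u → rank₀ u < rank₀ v) (sym parent₀-x) rank₀-q
        (no v≢x)   → subst (λ u → rank₀ u < rank₀ v) (sym (parent₀-other v≢x)) (rank₀-parent v≢ v≢x)

    q-pos : ∀ {i} → i < s → V₀ (q (suc i)) ⊎ ∃[ j ] 2 + i ≤ j × j < s × q (suc i) ≡ x (suc j)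
    q-pos {i} i<s with desc? (x 0) (q (suc i))
    ... | no ¬d = inj₁ (nondesc∈V₀ ¬d)
    ... | yes d with q-split (ℕ.≤-trans i<s (ℕ.<⇒≤ s<m)) d
    ...   | inj₂ d′ = inj₁ λ (k , k<s , eq) → x-not-below-end (ℕ.≤-trans k<s (ℕ.<⇒≤ s<m)) (subst (Desc (x (suc m))) eq d′)
    ...   | inj₁ (suc j , gap , j≤m , q≡x) with j ℕ.<? s
    ...     | yes j<s = inj₂ (j , s≤s⁻¹ gap , j<s , q≡x)
    ...     | no j≮s  = inj₁ λ (k , k<s , eq) →
      j≮s (subst (_< s) (ℕ.suc-injective (x-inj (bound k<s) (ℕ.m≤n⇒m≤1+n j≤m) (trans (sym eq) q≡x))) k<s)

    length≤3ℓ : s ≤ 3 * ℓ D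
    length≤3ℓ = Extension.length≤3ℓ remainder s (x ∘ suc) (q ∘ suc)
      (λ i<s ∉V₀ → ∉V₀ (_ , i<s , refl))
      (λ i<s j<s eq → ℕ.suc-injective (x-inj (bound i<s) (bound j<s) eq))
      (λ 1+i<s → x-arc (s≤s⁻¹ (bound 1+i<s)))
      (λ {i} _ → q-arc (suc i))
      q-pos

  length≤ : m ≤ 1 + 6 * ℓ D
  length≤ with last-or-zero (λ i → ¬? (desc? (x 0) (q i))) m
  ... | s , s≤m , s-spec , none = begin
    m                       ≡⟨ ℕ.m+[n∸m]≡n s≤m ⟨
    s + (m ∸ s)             ≤⟨ ℕ.+-mono-≤ (lower s s≤m s-spec)
                                 (upper≤3ℓ s s≤m λ i s<i i≤m → decidable-stable (desc? _ _) (none i s<i i≤m)) ⟩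
    1 + (3 * ℓ D + 3 * ℓ D) ≡⟨ cong suc (ℕ.*-distribʳ-+ (ℓ D) 3 3) ⟨
    1 + 6 * ℓ D             ∎
    where
    open ℕ.≤-Reasoning
    lower : ∀ s → s ≤ m → s ≡ 0 ⊎ ¬ Desc (x 0) (q s) → s ≤ 1 + 3 * ℓ D
    lower zero    _   _              = z≤n
    lower (suc s) s<m (inj₂ q-outside) = s≤s (Lower.length≤3ℓ s s<m q-outside)

-- Counting the vertices

module BreadthFirstBound {D : Digraph n} (T : OutTree D) (bfs : IsBreadthFirst T) (spare : HasSpareInNeighbours D) where

  open OutTree T
  open IsBreadthFirst bfs
  open Descendants T spanning

  ancestor : ℕ → Fin n → Fin n
  ancestor zero    v = v
  ancestor (suc i) v = ancestor i (parent v)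

  next : Fin n → Fin n
  next v with unary? v
  ... | yes (w , _) = w
  ... | no _        = v

  next-only : ∀ {v} → Unary v → OnlyChild v (next v)
  next-only {v} unary with unary? v
  ... | yes (w , only) = only
  ... | no ¬unary      = contradiction unary ¬unary

  chain : Fin n → ℕ → Fin n
  chain v zero    = v
  chain v (suc i) = next (chain v i)

  -- The equation with `ancestor` lets `v` be recovered from the end of its chain and the number of
  -- steps, which is what `order≤` counts.
  first-non-unary : ∀ v f →
    (∃[ i ] i < f × ∃[ e ] ¬ Unary e × ancestor i e ≡ v) ⊎
    ((∀ {i} → i < f → Unary (chain v i)) × ancestor f (chain v f) ≡ v)
  first-non-unary v zero = inj₂ ((λ ()) , refl)
  first-non-unary v (suc f) with first-non-unary v f
  ... | inj₁ (i , i<f , found) = inj₁ (i , ℕ.m≤n⇒m≤1+n i<f , found)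
  ... | inj₂ (unary , anc) with unary? (chain v f)
  ...   | no ¬unary     = inj₁ (f , ℕ.n<1+n f , chain v f , ¬unary , anc)
  ...   | yes unary-f   = inj₂
    ( (λ i<1+f → case ℕ.m≤n⇒m<n∨m≡n (s≤s⁻¹ i<1+f) of λ where
        (inj₁ i<f)  → unary i<f
        (inj₂ refl) → unary-f)
    , trans (cong (ancestor f) (proj₂ (proj₂ (proj₁ (proj₂ unary-f))))) anc)

  non-unary-descendant : ∀ {b} → 1 + 6 * ℓ D < b → ∀ v → ∃[ i ] i < suc b × ∃[ e ] ¬ Unary e × ancestor i e ≡ v
  non-unary-descendant {b} b> v with first-non-unary v (suc b)
  ... | inj₁ found       = found
  ... | inj₂ (unary , _) = contradiction
    -- The first `suc b` vertices of the chain are unary, which is a path with `m = b`.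
    (UnaryPath.length≤ T bfs spare (chain v) b λ i≤ → next-only (unary (s≤s i≤)))
    (ℕ.<⇒≱ b>)

  Branching : Fin n → Set
  Branching v = ∃[ w ] Child v w × ∃[ u ] Child v u × u ≢ w

  branching? : ∀ v → Dec (Branching v)
  branching? v = Fin.any? λ w → child? v w ×-dec Fin.any? λ u → child? v u ×-dec ¬? (u Fin.≟ w)

  -- One child of each branching vertex is set aside. Its siblings are not, as distinct vertices
  -- have disjoint sets of children, so `siblings<ℓ` bounds the number of branching vertices.
  second : Fin n → Fin n
  second v with branching? v
  ... | yes (w , _) = w
  ... | no _        = v

  second-spec : ∀ {v} → Branching v → Child v (second v) × ∃[ u ] Child v u × u ≢ second v
  second-spec {v} b with branching? v
  ... | yes (_ , spec) = spec
  ... | no ¬b          = contradiction b ¬b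

  outer inner : List (Fin n)
  outer = filter leaf? (allFin n)
  inner = filter branching? (allFin n)

  ∈-inner⁻ : ∀ {v} → v ∈ˡ inner → Branching v
  ∈-inner⁻ = proj₂ ∘ ∈-filter⁻ branching? {xs = allFin n}

  parent-second : ∀ {v} → v ∈ˡ inner → parent (second v) ≡ v
  parent-second v∈ = proj₂ (proj₂ (proj₁ (second-spec (∈-inner⁻ v∈))))

  inner<ℓ : length inner < ℓ D
  inner<ℓ = subst (_< ℓ D) (List.length-map second inner) (siblings<ℓ
    (map-unique-on second (Unique.filter⁺ branching? (Unique.allFin⁺ n)) λ u∈ v∈ eq →
      trans (sym (parent-second u∈)) (trans (cong parent eq) (parent-second v∈)))
    sibling)
    where
    sibling : ∀ {x} → x ∈ˡ List.map second inner →
      V x × x ≢ root × ∃[ y ] Child (parent x) y × y ∉ˡ List.map second inner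
    sibling x∈ with ∈-map⁻ second x∈
    ... | v , v∈ , refl with second-spec (∈-inner⁻ v∈)
    ...   | (x∈V , x≢ , p) , y , y-child@(_ , _ , py) , y≢ =
      x∈V , x≢ , y , subst (λ u → Child u y) (sym p) y-child , λ y∈ → case ∈-map⁻ second y∈ of λ where
        (w , w∈ , refl) → y≢ (cong second (trans (sym (parent-second w∈)) py))

  non-unary⊆ : ∀ {v} → ¬ Unary v → v ∈ˡ outer ++ inner
  non-unary⊆ {v} ¬unary with Fin.any? (child? v)
  ... | no childless = ∈-++⁺ˡ (∈-filter⁺ leaf? (∈-allFin v) (spanning v , childless))
  ... | yes (w , c) with branching? v
  ...   | yes b = ∈-++⁺ʳ outer (∈-filter⁺ branching? (∈-allFin v) b)
  ...   | no ¬b = contradiction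
    (w , c , λ u c′ → decidable-stable (u Fin.≟ w) λ u≢w → ¬b (w , c , u , c′ , u≢w)) ¬unary

  -- Each vertex is the i-th ancestor of a leaf or branching vertex. The least `b` allowed in
  -- `non-unary-descendant` is `2 + 6 * ℓ D`, which leaves `3 + 6 * ℓ D` values of i.
  order≤ : n ≤ (3 + 6 * ℓ D) * (length outer + length inner)
  order≤ = begin
    n                                                    ≡⟨ List.length-tabulate id ⟨
    length (allFin n)                                    ≤⟨ length-⊆ (Unique.allFin⁺ n) (λ {v} _ → reached v) ⟩
    length (cartesianProductWith ancestor steps (outer ++ inner))
                                                         ≡⟨ length-cartesianProductWith ancestor steps (outer ++ inner) ⟩
    length steps * length (outer ++ inner)               ≡⟨ cong₂ _*_ (List.length-upTo (3 + 6 * ℓ D)) (List.length-++ outer) ⟩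
    (3 + 6 * ℓ D) * (length outer + length inner)        ∎
    where
    open ℕ.≤-Reasoning
    steps = upTo (3 + 6 * ℓ D)
    reached : ∀ v → v ∈ˡ cartesianProductWith ancestor steps (outer ++ inner)
    reached v with i , i< , e , ¬unary , refl ← non-unary-descendant ℕ.≤-refl v =
      ∈-cartesianProductWith⁺ ancestor (∈-upTo⁺ i<) (non-unary⊆ ¬unary)

  order≤16ℓ² : n ≤ 16 * ℓ D ^ 2
  order≤16ℓ² = ℕ.≤-trans order≤ (quadratic (ℓ D) (ℕ.+-mono-≤-<
    (leaves≤ℓ (Unique.filter⁺ leaf? (Unique.allFin⁺ n)) (proj₂ ∘ ∈-filter⁻ leaf? {xs = allFin n})) inner<ℓ))
    where
    open ℕ.≤-Reasoning
    open +-*-Solver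
    -- With ℓ = k + 1 the left product is 12ℓ² - 3; the added polynomial is the slack 4ℓ² + 3
    -- written in k.
    expand : ∀ k → (3 + 6 * suc k) * (k + suc k) + (4 * k * k + 8 * k + 7) ≡ 16 * suc k ^ 2
    expand = solve 1 (λ k →
      (con 3 :+ con 6 :* (con 1 :+ k)) :* (k :+ (con 1 :+ k)) :+ (con 4 :* k :* k :+ con 8 :* k :+ con 7) :=
      con 16 :* (con 1 :+ k) :^ 2) refl
    quadratic : ∀ k {t} → t < k + k → (3 + 6 * k) * t ≤ 16 * k ^ 2
    quadratic (suc k) {t} t<2k = begin
      (3 + 6 * suc k) * t                               ≤⟨ ℕ.*-monoʳ-≤ (3 + 6 * suc k) (s≤s⁻¹ t<2k) ⟩
      (3 + 6 * suc k) * (k + suc k)                     ≤⟨ ℕ.m≤m+n _ (4 * k * k + 8 * k + 7) ⟩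
      (3 + 6 * suc k) * (k + suc k) + (4 * k * k + 8 * k + 7) ≡⟨ expand k ⟩
      16 * suc k ^ 2                                    ∎

-- The bound is squared to stay within the natural numbers.
theorem4 : (n : ℕ) (D : Digraph n) →
    HasOutBranching D →
    MinInDegree≥ 3 D ⊎ (IsOriented D × MinInDegree≥ 2 D) →
    n ≤ 16 * ℓ D ^ 2
theorem4 n D branching degrees =
  let r , reach = branching-walks D branching
      T , bfs   = breadthFirst D r reach
  in  BreadthFirstBound.order≤16ℓ² T bfs (hasSpareInNeighbours D degrees)
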